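{- Let $\mathcal{H}=(V,E)$ be a linear hypergraph without loop with $n$ vertices, and suppose $E$ can be partitioned as $E=E'\sqcup E''$ such that, with $\mathcal{H}'=(V,E')$: (i) $\mathrm{ar}(\mathcal{H}')\ge\sqrt{n}$; (ii) $|e|<\sqrt{n}$ for every $e\in E''$; (iii) for every $e\in E''$ there exists $x_0\in e$ with $\mathrm{deg}_{\mathcal{H}}(x_0)\le |e|$. Then $\mathrm{q}(\mathcal{H})\le \Delta([\mathcal{H}]_2)+1$.
   Context: A hypergraph $\mathcal{H}=(V,E)$ has a finite vertex set $V$ and a finite set $E$ of nonempty subsets of $V$ (hyperedges); a loop is a hyperedge with one element; linear means distinct hyperedges share at most one vertex. $\mathrm{deg}_{\mathcal{H}}(x)$ is the number of hyperedges containing $x$. The antirank $\mathrm{ar}$ is the minimum cardinality of a hyperedge ($\infty$ if there are none). The 2-section $[\mathcal{H}]_2$ is the simple graph on $V$ where distinct vertices are adjacent iff some hyperedge contains both; $\Delta([\mathcal{H}]_2)$ is its maximum degree. The chromatic index $\mathrm{q}(\mathcal{H})$ is the least number of colors in a coloring of hyperedges where distinct intersecting hyperedges get different colors. -}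

module Defs where

open import Data.Fin using (Fin)
open import Data.Fin.Base using (finToFun; funToFin)
open import Data.Fin.Properties as Fin using (any?; all?; finToFun-funToFin)
open import Data.Fin.Subset using (Subset; Nonempty; _∈_; _∩_; ∣_∣)
open import Data.Fin.Subset.Properties using (_∈?_; nonempty?)
open import Data.Bool.Properties as Bool using ()
open import Data.List using (List; length; filter; map; lookup; allFin)
open import Data.List.Extrema using (min)
open import Data.List.Extrema.Nat using (max)
open import Data.List.Membership.Propositional using () renaming (_∈_ to _∈ₗ_)
open import Data.List.Relation.Unary.All using (All)
open import Data.List.Relation.Unary.Any as Any using (Any)
open import Data.List.Relation.Unary.Unique.Propositional using (Unique)
open import Data.Nat using (ℕ; zero; suc; _*_; _≤_; _<_; z≤n; s≤s)
open import Data.Nat.Properties as ℕ using ()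
open import Data.Product using (∃; _×_; _,_; proj₁; proj₂; swap)
open import Data.Unit using (⊤)
open import Data.Vec.Properties using (≡-dec)
open import Function using (_∘_)
open import Level using (0ℓ)
open import Relation.Binary.Bundles using (TotalOrder)
open import Relation.Binary.Core using (Rel)
open import Relation.Binary.Definitions using (Symmetric; Irreflexive) renaming (Decidable to Decidable₂)
open import Relation.Binary.PropositionalEquality using (_≡_; _≢_; cong; sym; trans)
open import Relation.Binary.Construct.Add.Supremum.NonStrict _≤_ using (_≤⁺_; ≤⁺-isTotalOrder-≡)
open import Relation.Nullary using (¬_; Dec; yes; no; contradiction)
open import Relation.Nullary.Construct.Add.Supremum using (_⁺; ⊤⁺; [_])
open import Relation.Nullary.Decidable using (_×-dec_; _→-dec_; ¬?; map′)
open import Relation.Unary using (Pred; Decidable)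

-- The vertex set is Fin n; the set of hyperedges is a repetition-free list.
record Hypergraph (n : ℕ) : Set where
  field
    edges    : List (Subset n)
    distinct : Unique edges
    nonempty : All Nonempty edges

open Hypergraph public

IsLoop : ∀ {n} → Subset n → Set
IsLoop e = ∣ e ∣ ≡ 1

Loopless : ∀ {n} → Hypergraph n → Set
Loopless H = ∀ {e} → e ∈ₗ edges H → ¬ IsLoop e

Linear : ∀ {n} → Hypergraph n → Set
Linear H = ∀ {e f} → e ∈ₗ edges H → f ∈ₗ edges H → e ≢ f → ∣ e ∩ f ∣ ≤ 1

deg : ∀ {n} → Hypergraph n → Fin n → ℕ
deg H x = length (filter (x ∈?_) (edges H))

-- ℕ ⁺ is ℕ with a top element ⊤⁺, playing the role of ∞.
ℕ⁺-totalOrder : TotalOrder 0ℓ 0ℓ 0ℓ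
ℕ⁺-totalOrder = record { isTotalOrder = ≤⁺-isTotalOrder-≡ ℕ.≤-isTotalOrder }

ar : ∀ {n} → Hypergraph n → ℕ ⁺
ar H = min ℕ⁺-totalOrder ⊤⁺ (map (λ e → [ ∣ e ∣ ]) (edges H))

-- Comparisons with the real number √n, squared so as to stay within ℕ.
infix 4 √_≤⁺_ _<√_

√_≤⁺_ : ℕ → ℕ ⁺ → Set
√ n ≤⁺ ⊤⁺    = ⊤
√ n ≤⁺ [ k ] = n ≤ k * k

_<√_ : ℕ → ℕ → Set
k <√ n = k * k < n

record SimpleGraph (n : ℕ) : Set₁ where
  field
    Adj         : Rel (Fin n) 0ℓ
    adj?        : Decidable₂ Adj
    symmetric   : Symmetric Adj
    irreflexive : Irreflexive _≡_ Adj

open SimpleGraph public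

degree : ∀ {n} → SimpleGraph n → Fin n → ℕ
degree {n} G x = length (filter (adj? G x) (allFin n))

-- For n = 0 this is 0.
Δ : ∀ {n} → SimpleGraph n → ℕ
Δ {n} G = max 0 (map (degree G) (allFin n))

[_]₂ : ∀ {n} → Hypergraph n → SimpleGraph n
[ H ]₂ = record
  { Adj         = λ x y → x ≢ y × Any (λ e → x ∈ e × y ∈ e) (edges H)
  ; adj?        = λ x y → ¬? (x Fin.≟ y)
                          ×-dec Any.any? (λ e → x ∈? e ×-dec y ∈? e) (edges H)
  ; symmetric   = λ (x≢y , p) → x≢y ∘ sym , Any.map swap p
  ; irreflexive = λ x≡y (x≢y , _) → x≢y x≡y
  }

-- A colouring assigns a colour to each position of the list of hyperedges;
-- positions and hyperedges correspond since the list has no repetitions.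
IsColouring : ∀ {n} (H : Hypergraph n) {k : ℕ} → (Fin (length (edges H)) → Fin k) → Set
IsColouring H c = ∀ i j →
  lookup (edges H) i ≢ lookup (edges H) j →
  Nonempty (lookup (edges H) i ∩ lookup (edges H) j) →
  c i ≢ c j

Colourable : ∀ {n} → Hypergraph n → ℕ → Set
Colourable H k = ∃ λ (c : Fin (length (edges H)) → Fin k) → IsColouring H c

IsLeast : Pred ℕ 0ℓ → ℕ → Set
IsLeast P m = P m × (∀ {k} → P k → m ≤ k)

least : ∀ {P : Pred ℕ 0ℓ} → Decidable P → ∀ b → P b → ∃ (IsLeast P)
least P? zero    p = 0 , p , λ _ → z≤n
least P? (suc b) p with P? 0
... | yes p₀ = 0 , p₀ , λ _ → z≤n
... | no ¬p₀ with least (P? ∘ suc) b p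
...   | m , pm , m-min = suc m , pm ,
        λ { {zero} p₀ → contradiction p₀ ¬p₀ ; {suc k} pk → s≤s (m-min pk) }

colouring? : ∀ {n} (H : Hypergraph n) {k} (c : Fin (length (edges H)) → Fin k) →
             Dec (IsColouring H c)
colouring? H c = all? λ i → all? λ j →
  ¬? (≡-dec Bool._≟_ (lookup (edges H) i) (lookup (edges H) j))
  →-dec (nonempty? (lookup (edges H) i ∩ lookup (edges H) j)
  →-dec ¬? (c i Fin.≟ c j))

colourable? : ∀ {n} (H : Hypergraph n) → Decidable (Colourable H)
colourable? H k = map′
  (λ (a , col) → finToFun a , col)
  (λ (c , col) → funToFin c , λ i j e≢f meet same →
     col i j e≢f meet
       (trans (sym (finToFun-funToFin c i)) (trans same (finToFun-funToFin c j))))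
  (any? λ a → colouring? H (finToFun a))

trivialColouring : ∀ {n} (H : Hypergraph n) → Colourable H (length (edges H))
trivialColouring H = (λ i → i) , λ i j e≢f _ i≡j → e≢f (cong (lookup (edges H)) i≡j)

leastColours : ∀ {n} (H : Hypergraph n) → ∃ (IsLeast (Colourable H))
leastColours H = least (colourable? H) (length (edges H)) (trivialColouring H)

q : ∀ {n} → Hypergraph n → ℕ
q H = proj₁ (leastColours H)

q-isLeast : ∀ {n} (H : Hypergraph n) → IsLeast (Colourable H) (q H)
q-isLeast H = proj₂ (leastColours H)

{-# OPTIONS --safe #-}
module Submission where

-- Induct on the number of hyperedges in a subfamily L of E, with Δ + 1 colours.  A hyperedge
-- meeting at most Δ others in L can be deleted and coloured last.  If there is none, let e
-- be a hyperedge of L of minimum size k.  Each vertex x has (k − 1) d(x) ≤ Δ, where d is the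
-- degree in L, as the hyperedges of L through x are disjoint outside x.  If e ∈ E″, summing over
-- the vertices of e shows that e meets at most Δ others, a contradiction.  If e ∈ E′, then
-- n ≤ k², and a tight count forces Δ ≥ k² − 1, d = k + 1 on e, and then that L is an affine
-- plane of order k.  Its parallel classes, indexed by the lines through a fixed point, are a
-- colouring with k + 1 ≤ Δ + 1 colours.

open import Defs
open import Algebra.Properties.CommutativeSemigroup using (interchange)
open import Data.Bool.Properties as Bool using ()
open import Data.Fin as Fin using (Fin)
open import Data.Fin.Properties as Fin using ()
open import Data.Fin.Subset using (Subset; inside; outside; Nonempty; _∈_; _∩_; _-_; ∣_∣)
open import Data.Fin.Subset.Properties using (_∈?_; nonempty?; x∈p∩q⁺; x∈p∩q⁻; x∈p⇒∣p-x∣<∣p∣; x∈p∧x≢y⇒x∈p-y)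
open import Data.List using (List; []; _∷_; _++_; filter; length; map; allFin; tabulate; upTo)
open import Data.List.Extrema ℕ⁺-totalOrder using (min≤xs)
open import Data.List.Extrema.Nat using (argmin; argmin-all; f[argmin]≤f[⊤]; f[argmin]≤f[xs]; xs≤max)
open import Data.List.Membership.Propositional using (find; lose) renaming (_∈_ to _∈ₗ_)
open import Data.List.Membership.Propositional.Properties using (∈-++⁻; ∈-allFin; ∈-filter⁺; ∈-filter⁻; ∈-lookup; ∈-map⁺; ∈-upTo⁻)
open import Data.List.Properties using (filter-notAll; length-map; length-tabulate; length-upTo; map-tabulate)
open import Data.List.Relation.Binary.Permutation.Propositional using (_↭_)
open import Data.List.Relation.Binary.Permutation.Propositional.Properties using (∈-resp-↭)
open import Data.List.Relation.Unary.All as All using ([]; _∷_)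
open import Data.List.Relation.Unary.AllPairs using ([]; _∷_)
open import Data.List.Relation.Unary.Any as Any using (Any; here; there)
open import Data.List.Relation.Unary.Unique.Propositional using (Unique)
open import Data.List.Relation.Unary.Unique.Propositional.Properties using (filter⁺; allFin⁺; upTo⁺)
open import Data.Nat hiding (∣_-_∣)
open import Data.Nat.ListAction using (sum)
open import Data.Nat.Properties
open import Data.List.Membership.DecPropositional _≟_ using () renaming (_∈?_ to _∈ᴺ?_)
open import Data.Product using (∃; _×_; _,_; proj₁; proj₂)
open import Data.Sum using (_⊎_; inj₁; inj₂)
open import Data.Vec as Vec using ([]; _∷_)
open import Data.Vec.Properties using (≡-dec)
open import Function using (_∘_; id)
open import Level using (0ℓ)
open import Relation.Binary.Construct.Add.Supremum.NonStrict _≤_ using (_≤⁺_; [_])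
open import Relation.Binary.Definitions using (DecidableEquality)
open import Relation.Binary.PropositionalEquality
open import Relation.Nullary using (¬_; Dec; yes; no; contradiction)
open import Relation.Nullary.Construct.Add.Supremum using (_⁺; ⊤⁺; [_])
open import Relation.Nullary.Decidable using (_×-dec_; ¬?; decidable-stable)
open import Relation.Unary using (Pred; Decidable)

-- Indicators and finite sums over lists.

private variable
  A B : Set
  P Q : Set

𝟏 : Dec P → ℕ
𝟏 (yes _) = 1
𝟏 (no _)  = 0

𝟏-yes : (p? : Dec P) → P → 𝟏 p? ≡ 1
𝟏-yes (yes _) _ = refl
𝟏-yes (no ¬p) p = contradiction p ¬p

𝟏-no : (p? : Dec P) → ¬ P → 𝟏 p? ≡ 0
𝟏-no (yes p) ¬p = contradiction p ¬p
𝟏-no (no _)  _  = refl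

𝟏-mono : (p? : Dec P) (q? : Dec Q) → (P → Q) → 𝟏 p? ≤ 𝟏 q?
𝟏-mono (yes p) q? P→Q = ≤-reflexive (sym (𝟏-yes q? (P→Q p)))
𝟏-mono (no _)  q? _   = z≤n

𝟏-cong : (p? : Dec P) (q? : Dec Q) → (P → Q) → (Q → P) → 𝟏 p? ≡ 𝟏 q?
𝟏-cong p? q? P→Q Q→P = ≤-antisym (𝟏-mono p? q? P→Q) (𝟏-mono q? p? Q→P)

∑ : List A → (A → ℕ) → ℕ
∑ xs f = sum (map f xs)

syntax ∑ xs (λ x → t) = ∑[ x ← xs ] t

∑-mono : ∀ (xs : List A) {f g : A → ℕ} → (∀ {x} → x ∈ₗ xs → f x ≤ g x) → ∑ xs f ≤ ∑ xs g
∑-mono []       _   = z≤n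
∑-mono (x ∷ xs) f≤g = +-mono-≤ (f≤g (here refl)) (∑-mono xs (f≤g ∘ there))

∑-cong : ∀ (xs : List A) {f g : A → ℕ} → (∀ {x} → x ∈ₗ xs → f x ≡ g x) → ∑ xs f ≡ ∑ xs g
∑-cong xs f≡g = ≤-antisym (∑-mono xs (≤-reflexive ∘ f≡g)) (∑-mono xs (≤-reflexive ∘ sym ∘ f≡g))

∑-+ : ∀ (xs : List A) (f g : A → ℕ) → ∑[ x ← xs ] (f x + g x) ≡ ∑ xs f + ∑ xs g
∑-+ []       f g = refl
∑-+ (x ∷ xs) f g =
  trans (cong (f x + g x +_) (∑-+ xs f g)) (interchange +-commutativeSemigroup (f x) (g x) (∑ xs f) (∑ xs g))

∑-* : ∀ (xs : List A) c (f : A → ℕ) → ∑[ x ← xs ] (c * f x) ≡ c * ∑ xs f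
∑-* []       c f = sym (*-zeroʳ c)
∑-* (x ∷ xs) c f = trans (cong (c * f x +_) (∑-* xs c f)) (sym (*-distribˡ-+ c (f x) (∑ xs f)))

∑-const : ∀ (xs : List A) c → ∑[ _ ← xs ] c ≡ length xs * c
∑-const []       c = refl
∑-const (_ ∷ xs) c = cong (c +_) (∑-const xs c)

∑-1 : ∀ (xs : List A) → ∑[ _ ← xs ] 1 ≡ length xs
∑-1 xs = trans (∑-const xs 1) (*-identityʳ (length xs))

∑-comm : ∀ (xs : List A) (ys : List B) (f : A → B → ℕ) →
         ∑[ x ← xs ] ∑[ y ← ys ] f x y ≡ ∑[ y ← ys ] ∑[ x ← xs ] f x y
∑-comm []       ys f = sym (trans (∑-const ys 0) (*-zeroʳ (length ys)))
∑-comm (x ∷ xs) ys f =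
  trans (cong (∑ ys (f x) +_) (∑-comm xs ys f)) (sym (∑-+ ys (f x) (λ y → ∑[ x ← xs ] f x y)))

∑-∈ : ∀ {xs : List A} {x} (f : A → ℕ) → x ∈ₗ xs → f x ≤ ∑ xs f
∑-∈ {xs = x ∷ xs} f (here refl)  = m≤m+n (f x) (∑ xs f)
∑-∈ {xs = x ∷ xs} f (there x∈xs) = ≤-trans (∑-∈ f x∈xs) (m≤n+m (∑ xs f) (f x))

-- Slack in a single term would survive in the totals. The equality cases of the counting bounds
-- below are read off in this way.
∑-tight : ∀ (xs : List A) {f g : A → ℕ} → (∀ {x} → x ∈ₗ xs → f x ≤ g x) → ∑ xs g ≤ ∑ xs f →
          ∀ {x} → x ∈ₗ xs → f x ≡ g x
∑-tight (x ∷ xs) {f} {g} f≤g ∑g≤∑f (here refl) = ≤-antisym (f≤g (here refl))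
  (+-cancelʳ-≤ (∑ xs f) (g x) (f x)
    (≤-trans (+-monoʳ-≤ (g x) (∑-mono xs (f≤g ∘ there))) ∑g≤∑f))
∑-tight (x ∷ xs) {f} {g} f≤g ∑g≤∑f (there x∈xs) = ∑-tight xs (f≤g ∘ there)
  (+-cancelˡ-≤ (f x) (∑ xs g) (∑ xs f)
    (≤-trans (+-monoˡ-≤ (∑ xs g) (f≤g (here refl))) ∑g≤∑f)) x∈xs

∑-< : ∀ (xs : List A) {f g : A → ℕ} → ∑ xs f < ∑ xs g → ∃ λ x → x ∈ₗ xs × f x < g x
∑-< (x ∷ xs) {f} {g} ∑f<∑g with f x <? g x
... | yes fx<gx = x , here refl , fx<gx
-- The head of `f` is at least that of `g`, so the strict inequality has to come from the tails.
... | no  fx≮gx with ∑-< xs {f} {g} (≰⇒> λ ∑g≤∑f →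
  <⇒≱ ∑f<∑g (+-mono-≤ (≮⇒≥ fx≮gx) ∑g≤∑f))
...   | y , y∈xs , fy<gy = y , there y∈xs , fy<gy

∑-map : ∀ (h : B → A) (f : A → ℕ) ys → ∑ (map h ys) f ≡ ∑ ys (f ∘ h)
∑-map h f []       = refl
∑-map h f (y ∷ ys) = cong (f (h y) +_) (∑-map h f ys)

-- Counting the entries with a property.

module _ {P : Pred A 0ℓ} (P? : Decidable P) where

  count : List A → ℕ
  count xs = ∑[ x ← xs ] 𝟏 (P? x)

  length-filter≡count : ∀ xs → length (filter P? xs) ≡ count xs
  length-filter≡count []       = refl
  length-filter≡count (x ∷ xs) with P? x
  ... | yes _ = cong suc (length-filter≡count xs)
  ... | no _  = length-filter≡count xs

  count-none : ∀ xs → (∀ {x} → x ∈ₗ xs → ¬ P x) → count xs ≡ 0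
  count-none xs ¬p = trans (∑-cong xs (λ {x} x∈xs → 𝟏-no (P? x) (¬p x∈xs)))
                           (trans (∑-const xs 0) (*-zeroʳ (length xs)))

  count-some : ∀ {x xs} → x ∈ₗ xs → P x → 1 ≤ count xs
  count-some {x} x∈xs px = ≤-trans (≤-reflexive (sym (𝟏-yes (P? x) px))) (∑-∈ (𝟏 ∘ P?) x∈xs)

  count-unique : ∀ {xs} → Unique xs → (∀ {x y} → x ∈ₗ xs → y ∈ₗ xs → P x → P y → x ≡ y) →
                 count xs ≤ 1
  count-unique []                      _   = z≤n
  count-unique {x ∷ xs} (x≢xs ∷ uniq) inj with P? x
  ... | yes px = s≤s (≤-reflexive (count-none xs λ y∈xs py →
                   All.lookup x≢xs y∈xs (inj (here refl) (there y∈xs) px py)))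
  ... | no _   = count-unique uniq λ x∈xs y∈xs → inj (there x∈xs) (there y∈xs)

module _ (_≟_ : DecidableEquality A) where

  count-≡ : ∀ {x xs} → Unique xs → x ∈ₗ xs → count (_≟ x) xs ≡ 1
  count-≡ uniq x∈xs = ≤-antisym
    (count-unique (_≟ _) uniq λ _ _ y≡x z≡x → trans y≡x (sym z≡x))
    (count-some (_≟ _) x∈xs refl)

  -- Lets a pointwise estimate carry a correction at one exceptional entry, which summation turns
  -- into a single extra term.
  ∑-indicator : ∀ {x xs} c → Unique xs → x ∈ₗ xs → ∑[ y ← xs ] (c * 𝟏 (y ≟ x)) ≡ c
  ∑-indicator {x} {xs} c uniq x∈xs = trans (∑-* xs c (λ y → 𝟏 (y ≟ x)))
    (trans (cong (c *_) (count-≡ uniq x∈xs)) (*-identityʳ c))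

  -- Double counting of the equal pairs: each entry of `xs` occurs somewhere in `ys`, and each entry
  -- of `ys` occurs at most once in `xs`.
  length-mono-⊆ : ∀ {xs ys} → Unique xs → (∀ {x} → x ∈ₗ xs → x ∈ₗ ys) → length xs ≤ length ys
  length-mono-⊆ {xs} {ys} uniq xs⊆ys = begin
    length xs                              ≡⟨ ∑-1 xs ⟨
    ∑[ x ← xs ] 1                          ≤⟨ ∑-mono xs (λ x∈xs → count-some (_ ≟_) (xs⊆ys x∈xs) refl) ⟩
    ∑[ x ← xs ] ∑[ y ← ys ] 𝟏 (x ≟ y)      ≡⟨ ∑-comm xs ys (λ x y → 𝟏 (x ≟ y)) ⟩
    ∑[ y ← ys ] count (_≟ y) xs            ≤⟨ ∑-mono ys (λ _ → count-unique (_≟ _) uniq λ _ _ x≡y z≡y → trans x≡y (sym z≡y)) ⟩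
    ∑[ y ← ys ] 1                          ≡⟨ ∑-1 ys ⟩
    length ys                              ∎
    where open ≤-Reasoning

-- Index of the first match in a list.

module _ {A : Set} where

  -- Serves later as the number of a parallel class. Without a match the value is `length xs`, one
  -- past the last index.
  position : ∀ {P : Pred A 0ℓ} → Decidable P → List A → ℕ
  position P? []       = 0
  position P? (x ∷ xs) with P? x
  ... | yes _ = 0
  ... | no  _ = suc (position P? xs)

  position<length : ∀ {P : Pred A 0ℓ} (P? : Decidable P) {xs} → Any P xs → position P? xs < length xs
  position<length P? {x ∷ xs} any with P? x
  ... | yes _  = s≤s z≤n
  ... | no ¬px = s≤s (position<length P? (Any.tail ¬px any))

  -- Both searches stop at the same entry, which therefore satisfies both predicates.
  position-≡ : ∀ {P Q : Pred A 0ℓ} (P? : Decidable P) (Q? : Decidable Q) {xs} → Any P xs → Any Q xs →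
               position P? xs ≡ position Q? xs → ∃ λ x → x ∈ₗ xs × P x × Q x
  position-≡ P? Q? {x ∷ xs} anyP anyQ eq with P? x | Q? x
  ... | yes px | yes qx = x , here refl , px , qx
  ... | no ¬px | no ¬qx with position-≡ P? Q? (Any.tail ¬px anyP) (Any.tail ¬qx anyQ) (suc-injective eq)
  ...   | y , y∈xs , py , qy = y , there y∈xs , py , qy

count-∈? : ∀ {n} (e : Subset n) → count (_∈? e) (allFin n) ≡ ∣ e ∣
count-∈? {zero}  []      = refl
count-∈? {suc n} (s ∷ e) = trans (cong (𝟏 (Fin.zero ∈? (s ∷ e)) +_) tail) (head s)
  where
  tail : ∑ (tabulate Fin.suc) (λ x → 𝟏 (x ∈? (s ∷ e))) ≡ ∣ e ∣
  tail = begin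
    ∑ (tabulate Fin.suc) (λ x → 𝟏 (x ∈? (s ∷ e)))
      ≡⟨ cong (λ xs → ∑ xs (λ x → 𝟏 (x ∈? (s ∷ e)))) (map-tabulate id Fin.suc) ⟨
    ∑ (map Fin.suc (allFin n)) (λ x → 𝟏 (x ∈? (s ∷ e)))
      ≡⟨ ∑-map Fin.suc (λ x → 𝟏 (x ∈? (s ∷ e))) (allFin n) ⟩
    ∑[ x ← allFin n ] 𝟏 (Fin.suc x ∈? (s ∷ e))
      ≡⟨ ∑-cong (allFin n) (λ {x} _ → 𝟏-cong (Fin.suc x ∈? (s ∷ e)) (x ∈? e)
           (λ { (Vec.there p) → p }) Vec.there) ⟩
    count (_∈? e) (allFin n)
      ≡⟨ count-∈? e ⟩
    ∣ e ∣ ∎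
    where open ≡-Reasoning
  head : ∀ s → 𝟏 (Fin.zero ∈? (s ∷ e)) + ∣ e ∣ ≡ ∣ s ∷ e ∣
  head inside  = refl
  head outside = refl

-- Pigeonhole: otherwise all `k` entries of `upTo k` would lie in the shorter list `used`.
free-colour : ∀ used {k} → length used < k → ∃ λ i → i < k × ¬ i ∈ₗ used
free-colour used {k} few with Any.any? (λ i → ¬? (i ∈ᴺ? used)) (upTo k)
... | yes free with find free
...   | i , i∈upTo , i∉used = i , ∈-upTo⁻ i∈upTo , i∉used
free-colour used {k} few | no ¬free = contradiction
  (subst (_≤ length used) (length-upTo k) (length-mono-⊆ _≟_ (upTo⁺ k) λ {i} i∈upTo →
    decidable-stable (i ∈ᴺ? used) λ i∉used → ¬free (lose i∈upTo i∉used)))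
  (<⇒≱ few)

-- Subsets, conflicts and colourings of families.

module _ {n : ℕ} where

  _≟ₛ_ : DecidableEquality (Subset n)
  _≟ₛ_ = ≡-dec Bool._≟_

  vertices : Subset n → List (Fin n)
  vertices e = filter (_∈? e) (allFin n)

  length-vertices : ∀ e → length (vertices e) ≡ ∣ e ∣
  length-vertices e = trans (length-filter≡count (_∈? e) (allFin n)) (count-∈? e)

  ∈-vertices⁺ : ∀ {x e} → x ∈ e → x ∈ₗ vertices e
  ∈-vertices⁺ {x} {e} = ∈-filter⁺ (_∈? e) (∈-allFin x)

  ∈-vertices⁻ : ∀ {x e} → x ∈ₗ vertices e → x ∈ e
  ∈-vertices⁻ {x} {e} x∈Ve = proj₂ (∈-filter⁻ (_∈? e) {xs = allFin n} x∈Ve)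

  unique-vertices : ∀ e → Unique (vertices e)
  unique-vertices e = filter⁺ (_∈? e) (allFin⁺ n)

  ∑-vertices-const : ∀ e c → ∑[ _ ← vertices e ] c ≡ ∣ e ∣ * c
  ∑-vertices-const e c = trans (∑-const (vertices e) c) (cong (_* c) (length-vertices e))

  ∑-vertices-1 : ∀ e → ∑[ _ ← vertices e ] 1 ≡ ∣ e ∣
  ∑-vertices-1 e = trans (∑-1 (vertices e)) (length-vertices e)

  two-elements : ∀ {x y} {e : Subset n} → x ≢ y → x ∈ e → y ∈ e → 1 < ∣ e ∣
  two-elements x≢y x∈e y∈e = ≤-trans
    (s≤s (≤-trans (s≤s z≤n) (x∈p⇒∣p-x∣<∣p∣ (x∈p∧x≢y⇒x∈p-y y∈e (x≢y ∘ sym)))))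
    (x∈p⇒∣p-x∣<∣p∣ x∈e)

  -- The size of `e ∩ f`, written as a sum over `vertices e` so that it can be interchanged with a
  -- sum over `f`.
  common : Subset n → Subset n → ℕ
  common e f = count (_∈? f) (vertices e)

  common-self : ∀ e → common e e ≡ ∣ e ∣
  common-self e = begin
    common e e             ≡⟨ ∑-cong (vertices e) (λ {x} x∈e → 𝟏-yes (x ∈? e) (∈-vertices⁻ x∈e)) ⟩
    ∑[ _ ← vertices e ] 1  ≡⟨ ∑-vertices-1 e ⟩
    ∣ e ∣                  ∎
    where open ≡-Reasoning

  Conflict : Subset n → Subset n → Set
  Conflict e f = e ≢ f × Nonempty (e ∩ f)

  conflict? : ∀ e f → Dec (Conflict e f)
  conflict? e f = ¬? (e ≟ₛ f) ×-dec nonempty? (e ∩ f)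

  conflict : ∀ {e f x} → e ≢ f → x ∈ e → x ∈ f → Conflict e f
  conflict e≢f x∈e x∈f = e≢f , _ , x∈p∩q⁺ (x∈e , x∈f)

  conflict-sym : ∀ {e f} → Conflict e f → Conflict f e
  conflict-sym {e} {f} (e≢f , x , x∈e∩f) with x∈p∩q⁻ e f x∈e∩f
  ... | x∈e , x∈f = conflict (e≢f ∘ sym) x∈f x∈e

  ¬conflict⇒≡ : ∀ {e f x} → ¬ Conflict e f → x ∈ e → x ∈ f → e ≡ f
  ¬conflict⇒≡ {e} {f} ¬c x∈e x∈f = decidable-stable (e ≟ₛ f) λ e≢f → ¬c (conflict e≢f x∈e x∈f)

  conflict⇒1≤common : ∀ {e f} → Conflict e f → 1 ≤ common e f
  conflict⇒1≤common {e} {f} (_ , x , x∈e∩f) with x∈p∩q⁻ e f x∈e∩f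
  ... | x∈e , x∈f = count-some (_∈? f) (∈-vertices⁺ x∈e) x∈f

  ¬conflict⇒common≡0 : ∀ {g f} → g ≢ f → ¬ Conflict g f → common g f ≡ 0
  ¬conflict⇒common≡0 {g} {f} g≢f ¬g∼f = count-none (_∈? f) (vertices g) λ x∈g x∈f →
    ¬g∼f (conflict g≢f (∈-vertices⁻ x∈g) x∈f)

  neighbours : List (Subset n) → Subset n → ℕ
  neighbours L e = length (filter (conflict? e) L)

  star : List (Subset n) → Fin n → List (Subset n)
  star L x = filter (x ∈?_) L

  -- The colour function lives on all subsets and is constrained only on `L`, so passing to a
  -- subfamily does not change its type.
  Colouring : List (Subset n) → ℕ → Set
  Colouring L k = ∃ λ (c : Subset n → ℕ) →
    (∀ {e} → e ∈ₗ L → c e < k) ×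
    (∀ {e f} → e ∈ₗ L → f ∈ₗ L → Conflict e f → c e ≢ c f)

  weaken-colouring : ∀ {L k m} → k ≤ m → Colouring L k → Colouring L m
  weaken-colouring k≤m (c , c<k , proper) = c , (λ e∈L → <-≤-trans (c<k e∈L) k≤m) , proper

  delete : Subset n → List (Subset n) → List (Subset n)
  delete e = filter (λ f → ¬? (f ≟ₛ e))

  -- The greedy step: the members in conflict with `e` are fewer than `k`, so their colours leave
  -- one free for `e`.
  extend-colouring : ∀ {L e k} → neighbours L e < k → Colouring (delete e L) k → Colouring L k
  extend-colouring {L} {e} {k} few (c , c<k , proper)
    with free-colour (map c (filter (conflict? e) L))
           (subst (_< k) (sym (length-map c (filter (conflict? e) L))) few)
  ... | i , i<k , i∉used = c′ , c′<k , proper′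
    where
    c′ : Subset n → ℕ
    c′ f with f ≟ₛ e
    ... | yes _ = i
    ... | no  _ = c f

    ∈-delete : ∀ {f} → f ∈ₗ L → f ≢ e → f ∈ₗ delete e L
    ∈-delete = ∈-filter⁺ (λ f → ¬? (f ≟ₛ e))

    c′<k : ∀ {f} → f ∈ₗ L → c′ f < k
    c′<k {f} f∈L with f ≟ₛ e
    ... | yes _   = i<k
    ... | no  f≢e = c<k (∈-delete f∈L f≢e)

    fresh : ∀ {f} → f ∈ₗ L → Conflict e f → i ≢ c f
    fresh f∈L e∼f refl = i∉used (∈-map⁺ c (∈-filter⁺ (conflict? e) f∈L e∼f))

    proper′ : ∀ {f g} → f ∈ₗ L → g ∈ₗ L → Conflict f g → c′ f ≢ c′ g
    proper′ {f} {g} f∈L g∈L f∼g with f ≟ₛ e | g ≟ₛ e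
    ... | yes refl | yes refl = contradiction refl (proj₁ f∼g)
    ... | yes refl | no _     = fresh g∈L f∼g
    ... | no _     | yes refl = fresh f∈L (conflict-sym f∼g) ∘ sym
    ... | no f≢e   | no g≢e   = proper (∈-delete f∈L f≢e) (∈-delete g∈L g≢e) f∼g

  -- Double counting in a linear family.

  module LinearFamily
    (L : List (Subset n)) (unique : Unique L)
    (linear : ∀ {e f x y} → e ∈ₗ L → f ∈ₗ L → x ≢ y → x ∈ e → y ∈ e → x ∈ f → y ∈ f → e ≡ f)
    where

    d : Fin n → ℕ
    d x = length (star L x)

    ∈-star⁻ : ∀ {x f} → f ∈ₗ star L x → f ∈ₗ L × x ∈ f
    ∈-star⁻ {x} = ∈-filter⁻ (x ∈?_)

    ∈-star⁺ : ∀ {x f} → f ∈ₗ L → x ∈ f → f ∈ₗ star L x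
    ∈-star⁺ {x} = ∈-filter⁺ (x ∈?_)

    unique-star : ∀ x → Unique (star L x)
    unique-star x = filter⁺ (x ∈?_) unique

    -- On the diagonal this is the degree; off it linearity allows at most 1. Hence the indicators
    -- of `y ≡ x` in the sums below.
    codeg : Fin n → Fin n → ℕ
    codeg x y = count (y ∈?_) (star L x)

    codeg-self : ∀ x → codeg x x ≡ d x
    codeg-self x = begin
      codeg x x            ≡⟨ ∑-cong (star L x) (λ {f} f∋x → 𝟏-yes (x ∈? f) (proj₂ (∈-star⁻ f∋x))) ⟩
      ∑[ _ ← star L x ] 1  ≡⟨ ∑-1 (star L x) ⟩
      d x                  ∎
      where open ≡-Reasoning

    codeg≤1 : ∀ {x y} → x ≢ y → codeg x y ≤ 1
    codeg≤1 {x} {y} x≢y = count-unique (y ∈?_) (unique-star x) λ e∋x f∋x y∈e y∈f →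
      let e∈L , x∈e = ∈-star⁻ e∋x
          f∈L , x∈f = ∈-star⁻ f∋x
      in linear e∈L f∈L x≢y x∈e y∈e x∈f y∈f

    common≤1 : ∀ {e f} → e ∈ₗ L → f ∈ₗ L → e ≢ f → common e f ≤ 1
    common≤1 {e} {f} e∈L f∈L e≢f = count-unique (_∈? f) (unique-vertices e)
      λ {x} {y} x∈Ve y∈Ve x∈f y∈f → decidable-stable (x Fin.≟ y) λ x≢y →
        e≢f (linear e∈L f∈L x≢y (∈-vertices⁻ x∈Ve) (∈-vertices⁻ y∈Ve) x∈f y∈f)

    ∑-sizes : ∀ x → ∑[ f ← star L x ] ∣ f ∣ ≡ ∑[ y ← allFin n ] codeg x y
    ∑-sizes x = trans (∑-cong (star L x) (λ {f} _ → sym (count-∈? f)))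
                      (∑-comm (star L x) (allFin n) (λ f y → 𝟏 (y ∈? f)))

    ∑-common : ∀ x g → ∑[ f ← star L x ] common g f ≡ ∑[ y ← vertices g ] codeg x y
    ∑-common x g = ∑-comm (star L x) (vertices g) (λ f y → 𝟏 (y ∈? f))

    ∑-d : ∀ e → ∑[ x ← vertices e ] d x ≡ ∑[ f ← L ] common e f
    ∑-d e = trans (∑-cong (vertices e) (λ {x} _ → length-filter≡count (x ∈?_) L))
                  (∑-comm (vertices e) L (λ x f → 𝟏 (x ∈? f)))

    -- In `∑[ f ← L ] common e f` the term of `e` itself is `∣ e ∣`, and every member in conflict
    -- with `e` adds at least 1.
    neighbours≤∑-d : ∀ {e} → e ∈ₗ L → neighbours L e + ∣ e ∣ ≤ ∑[ x ← vertices e ] d x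
    neighbours≤∑-d {e} e∈L = begin
      neighbours L e + ∣ e ∣
        ≡⟨ cong₂ _+_ (length-filter≡count (conflict? e) L)
             (sym (∑-indicator _≟ₛ_ ∣ e ∣ unique e∈L)) ⟩
      count (conflict? e) L + ∑[ f ← L ] (∣ e ∣ * 𝟏 (f ≟ₛ e))
        ≡⟨ ∑-+ L (λ f → 𝟏 (conflict? e f)) (λ f → ∣ e ∣ * 𝟏 (f ≟ₛ e)) ⟨
      ∑[ f ← L ] (𝟏 (conflict? e f) + ∣ e ∣ * 𝟏 (f ≟ₛ e))
        ≤⟨ ∑-mono L (λ {f} _ → pointwise f) ⟩
      ∑[ f ← L ] common e f
        ≡⟨ ∑-d e ⟨
      ∑[ x ← vertices e ] d x ∎
      where
      open ≤-Reasoning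
      pointwise : ∀ f → 𝟏 (conflict? e f) + ∣ e ∣ * 𝟏 (f ≟ₛ e) ≤ common e f
      pointwise f with f ≟ₛ e
      ... | yes refl = ≤-reflexive (trans
              (cong₂ _+_ (𝟏-no (conflict? e e) λ c → proj₁ c refl) (*-identityʳ ∣ e ∣))
              (sym (common-self e)))
      ... | no _ with conflict? e f
      ...   | yes e∼f = subst (λ t → suc t ≤ common e f) (sym (*-zeroʳ ∣ e ∣)) (conflict⇒1≤common e∼f)
      ...   | no  _   = subst (_≤ common e f) (sym (*-zeroʳ ∣ e ∣)) z≤n

    -- The indicators replace a subtraction: at `y ≡ x` both sides are `1 + d x`, elsewhere this is
    -- `codeg≤1`.
    codeg-bound : ∀ x y → codeg x y + 𝟏 (y Fin.≟ x) ≤ 1 + d x * 𝟏 (y Fin.≟ x)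
    codeg-bound x y with y Fin.≟ x
    ... | yes refl rewrite codeg-self x | *-identityʳ (d x) = ≤-reflexive (+-comm (d x) 1)
    ... | no y≢x rewrite *-zeroʳ (d x) | +-identityʳ (codeg x y) = codeg≤1 (y≢x ∘ sym)

    ∑-codeg+1 : ∀ x → ∑[ y ← allFin n ] (codeg x y + 𝟏 (y Fin.≟ x)) ≡ ∑[ f ← star L x ] ∣ f ∣ + 1
    ∑-codeg+1 x = trans (∑-+ (allFin n) (codeg x) (λ y → 𝟏 (y Fin.≟ x)))
      (cong₂ _+_ (sym (∑-sizes x)) (count-≡ Fin._≟_ (allFin⁺ n) (∈-allFin x)))

    ∑-bound : ∀ x → ∑[ y ← allFin n ] (1 + d x * 𝟏 (y Fin.≟ x)) ≡ n + d x
    ∑-bound x = trans (∑-+ (allFin n) (λ _ → 1) (λ y → d x * 𝟏 (y Fin.≟ x))) (cong₂ _+_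
      (trans (∑-1 (allFin n)) (length-tabulate {n = n} id))
      (∑-indicator Fin._≟_ (d x) (allFin⁺ n) (∈-allFin x)))

    -- Without `x`, the members through `x` are pairwise disjoint sets among the other n - 1
    -- vertices.
    ∑-sizes<n+d : ∀ x → ∑[ f ← star L x ] ∣ f ∣ + 1 ≤ n + d x
    ∑-sizes<n+d x = subst₂ _≤_ (∑-codeg+1 x) (∑-bound x) (∑-mono (allFin n) λ {y} _ → codeg-bound x y)

    -- Equality in `∑-sizes<n+d`: those disjoint sets cover every vertex other than `x`.
    codeg≡1 : ∀ {x y} → n + d x ≤ ∑[ f ← star L x ] ∣ f ∣ + 1 → x ≢ y → codeg x y ≡ 1
    codeg≡1 {x} {y} tight x≢y with y Fin.≟ x
       | ∑-tight (allFin n) (λ {y} _ → codeg-bound x y)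
           (subst₂ _≤_ (sym (∑-bound x)) (sym (∑-codeg+1 x)) tight) (∈-allFin y)
    ... | yes refl | _  = contradiction refl x≢y
    ... | no _     | eq = trans (sym (+-identityʳ (codeg x y))) (trans eq (cong suc (*-zeroʳ (d x))))

    -- The same disjoint sets lie in the neighbourhood of `x` in the 2-section; `d x` accounts for
    -- `x` itself, once per member through it.
    ∑-sizes≤d+degree : ∀ (H : Hypergraph n) → (∀ {f} → f ∈ₗ L → f ∈ₗ edges H) →
                       ∀ x → ∑[ f ← star L x ] ∣ f ∣ ≤ d x + degree [ H ]₂ x
    ∑-sizes≤d+degree H L⊆H x = begin
      ∑[ f ← star L x ] ∣ f ∣
        ≡⟨ ∑-sizes x ⟩
      ∑[ y ← allFin n ] codeg x y
        ≤⟨ ∑-mono (allFin n) (λ {y} _ → pointwise y) ⟩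
      ∑[ y ← allFin n ] (d x * 𝟏 (y Fin.≟ x) + 𝟏 (adj? [ H ]₂ x y))
        ≡⟨ ∑-+ (allFin n) (λ y → d x * 𝟏 (y Fin.≟ x)) (λ y → 𝟏 (adj? [ H ]₂ x y)) ⟩
      ∑[ y ← allFin n ] (d x * 𝟏 (y Fin.≟ x)) + count (adj? [ H ]₂ x) (allFin n)
        ≡⟨ cong₂ _+_
             (∑-indicator Fin._≟_ (d x) (allFin⁺ n) (∈-allFin x))
             (sym (length-filter≡count (adj? [ H ]₂ x) (allFin n))) ⟩
      d x + degree [ H ]₂ x ∎
      where
      open ≤-Reasoning
      pointwise : ∀ y → codeg x y ≤ d x * 𝟏 (y Fin.≟ x) + 𝟏 (adj? [ H ]₂ x y)
      pointwise y with y Fin.≟ x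
      ... | yes refl = ≤-trans (≤-reflexive (trans (codeg-self x) (sym (*-identityʳ (d x))))) (m≤m+n _ _)
      ... | no y≢x with adj? [ H ]₂ x y
      ...   | yes _   = ≤-trans (codeg≤1 (y≢x ∘ sym)) (m≤n+m 1 (d x * 0))
      ...   | no ¬adj = ≤-trans (≤-reflexive (count-none (y ∈?_) (star L x) λ f∋x y∈f →
                let f∈L , x∈f = ∈-star⁻ f∋x in ¬adj (y≢x ∘ sym , lose (L⊆H f∈L) (x∈f , y∈f)))) z≤n

    d*k≤∑-sizes : ∀ {k} → (∀ {f} → f ∈ₗ L → k ≤ ∣ f ∣) → ∀ x → d x * k ≤ ∑[ f ← star L x ] ∣ f ∣
    d*k≤∑-sizes {k} k≤ x = ≤-trans (≤-reflexive (sym (∑-const (star L x) k)))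
                                   (∑-mono (star L x) (λ f∋x → k≤ (proj₁ (∈-star⁻ f∋x))))

    ∑-d≤∣e∣*c⇒d≡c : ∀ {e c} → (∀ x → d x ≤ c) → ∣ e ∣ * c ≤ ∑[ x ← vertices e ] d x →
                      ∀ {x} → x ∈ e → d x ≡ c
    ∑-d≤∣e∣*c⇒d≡c {e} {c} d≤c tight x∈e = ∑-tight (vertices e) (λ {x} _ → d≤c x)
      (≤-trans (≤-reflexive (∑-vertices-const e c)) tight) (∈-vertices⁺ x∈e)

    -- Each vertex of `g` lies on exactly one member through `x`, so the star of `x` partitions `g`.
    ∑-common≡∣g∣ : ∀ {x g} → (∀ {y} → x ≢ y → codeg x y ≡ 1) → ¬ x ∈ g →
                   ∑[ f ← star L x ] common g f ≡ ∣ g ∣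
    ∑-common≡∣g∣ {x} {g} joined x∉g = begin
      ∑[ f ← star L x ] common g f     ≡⟨ ∑-common x g ⟩
      ∑[ y ← vertices g ] codeg x y    ≡⟨ ∑-cong (vertices g) (λ y∈g → joined λ { refl → x∉g (∈-vertices⁻ y∈g) }) ⟩
      ∑[ _ ← vertices g ] 1            ≡⟨ ∑-vertices-1 g ⟩
      ∣ g ∣                            ∎
      where open ≡-Reasoning

    common-star≤1 : ∀ {x f g} → g ∈ₗ L → ¬ x ∈ g → f ∈ₗ star L x → common g f ≤ 1
    common-star≤1 g∈L x∉g f∋x = let f∈L , x∈f = ∈-star⁻ f∋x in
      common≤1 g∈L f∈L λ { refl → x∉g x∈f }

    -- The star of `x` partitions `g` into parts of size at most 1, and the part in `e` is empty. So
    -- there are more members through `x` than vertices of `g`.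
    disjoint-through : ∀ {x e g} → (∀ {y} → x ≢ y → codeg x y ≡ 1) → g ∈ₗ L → ¬ x ∈ g →
      e ∈ₗ star L x → ¬ Conflict g e → ∣ g ∣ < d x
    disjoint-through {x} {e} {g} joined g∈L x∉g e∋x ¬g∼e = begin-strict
      ∣ g ∣                             ≡⟨ ∑-common≡∣g∣ joined x∉g ⟨
      -- If the sums agreed, tightness would give `common g e ≡ 1`, but it is 0.
      ∑[ f ← star L x ] common g f      <⟨ ≰⇒> (λ ∑1≤ → 0≢1+n (trans (sym (¬conflict⇒common≡0 g≢e ¬g∼e))
                                             (∑-tight (star L x) (common-star≤1 g∈L x∉g) ∑1≤ e∋x))) ⟩
      ∑[ f ← star L x ] 1               ≡⟨ ∑-1 (star L x) ⟩
      d x                               ∎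
      where
      open ≤-Reasoning
      g≢e : g ≢ e
      g≢e refl = x∉g (proj₂ (∈-star⁻ e∋x))

    -- As before, but with two empty parts. Adding 1 at `e` and at `e′` still leaves every term at
    -- most 1.
    two-disjoint-through : ∀ {x e e′ g} → (∀ {y} → x ≢ y → codeg x y ≡ 1) → g ∈ₗ L → ¬ x ∈ g →
      e ∈ₗ star L x → e′ ∈ₗ star L x → e ≢ e′ → ¬ Conflict g e → ¬ Conflict g e′ → suc ∣ g ∣ < d x
    two-disjoint-through {x} {e} {e′} {g} joined g∈L x∉g e∋x e′∋x e≢e′ ¬g∼e ¬g∼e′ = begin
      suc (suc ∣ g ∣)
        ≡⟨ +-comm 2 ∣ g ∣ ⟩
      ∣ g ∣ + 2
        ≡⟨ cong₂ _+_ (sym (∑-common≡∣g∣ joined x∉g))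
             (sym (cong₂ _+_ (count-≡ _≟ₛ_ (unique-star x) e∋x) (count-≡ _≟ₛ_ (unique-star x) e′∋x))) ⟩
      ∑ (star L x) (common g) + (count (_≟ₛ e) (star L x) + count (_≟ₛ e′) (star L x))
        ≡⟨ cong (∑ (star L x) (common g) +_) (∑-+ (star L x) (λ f → 𝟏 (f ≟ₛ e)) (λ f → 𝟏 (f ≟ₛ e′))) ⟨
      ∑ (star L x) (common g) + ∑[ f ← star L x ] (𝟏 (f ≟ₛ e) + 𝟏 (f ≟ₛ e′))
        ≡⟨ ∑-+ (star L x) (common g) (λ f → 𝟏 (f ≟ₛ e) + 𝟏 (f ≟ₛ e′)) ⟨
      ∑[ f ← star L x ] (common g f + (𝟏 (f ≟ₛ e) + 𝟏 (f ≟ₛ e′)))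
        ≤⟨ ∑-mono (star L x) pointwise ⟩
      ∑[ f ← star L x ] 1
        ≡⟨ ∑-1 (star L x) ⟩
      d x ∎
      where
      open ≤-Reasoning
      g≢ : ∀ {f} → f ∈ₗ star L x → g ≢ f
      g≢ f∋x refl = x∉g (proj₂ (∈-star⁻ f∋x))
      pointwise : ∀ {f} → f ∈ₗ star L x → common g f + (𝟏 (f ≟ₛ e) + 𝟏 (f ≟ₛ e′)) ≤ 1
      pointwise {f} f∋x with f ≟ₛ e | f ≟ₛ e′
      ... | yes refl | yes refl = contradiction refl e≢e′
      ... | yes refl | no _  = ≤-reflexive (cong (_+ 1) (¬conflict⇒common≡0 (g≢ f∋x) ¬g∼e))
      ... | no _  | yes refl = ≤-reflexive (cong (_+ 1) (¬conflict⇒common≡0 (g≢ f∋x) ¬g∼e′))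
      ... | no _  | no _  = ≤-trans (≤-reflexive (+-identityʳ _)) (common-star≤1 g∈L x∉g f∋x)

    -- Parallel classes of an affine plane.

    parallel-colouring : ∀ {k} → (∀ {x y} → x ≢ y → codeg x y ≡ 1) → (∀ {f} → f ∈ₗ L → ∣ f ∣ ≡ k) →
                         (∀ x → d x ≡ suc k) → Fin n → Colouring L (suc k)
    parallel-colouring {k} joined size regular p = c , c<suc-k , proper
      where
      -- Parallel means equal or disjoint. The colour of `g` is the index of the first line through
      -- `p` parallel to it.
      ∥? : ∀ g f → Dec (¬ Conflict g f)
      ∥? g f = ¬? (conflict? g f)

      c : Subset n → ℕ
      c g = position (∥? g) (star L p)

      -- A line through `p` is parallel to itself. A line missing `p` has only `k` points, too few
      -- to meet all `k + 1` lines through `p`, which share no point of it.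
      parallel : ∀ {g} → g ∈ₗ L → Any (λ f → ¬ Conflict g f) (star L p)
      parallel {g} g∈L with p ∈? g | Any.any? (∥? g) (star L p)
      ... | yes p∈g | _       = lose (∈-star⁺ g∈L p∈g) (λ g∼g → proj₁ g∼g refl)
      ... | no  _   | yes any = any
      ... | no  p∉g | no ¬any = contradiction (begin
        suc k                           ≡⟨ regular p ⟨
        d p                             ≡⟨ ∑-1 (star L p) ⟨
        ∑[ f ← star L p ] 1             ≤⟨ ∑-mono (star L p) (λ {f} f∋p → conflict⇒1≤common
                                             (decidable-stable (conflict? g f) (¬any ∘ lose f∋p))) ⟩
        ∑[ f ← star L p ] common g f    ≡⟨ ∑-common≡∣g∣ joined p∉g ⟩
        ∣ g ∣                           ≡⟨ size g∈L ⟩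
        k                               ∎) 1+n≰n
        where open ≤-Reasoning

      c<suc-k : ∀ {g} → g ∈ₗ L → c g < suc k
      c<suc-k {g} g∈L = subst (c g <_) (regular p) (position<length (∥? g) (parallel g∈L))

      -- If distinct `g` and `h` met in a point `x` off `f`, two lines through `x` would miss `f`,
      -- forcing `d x` to be at least `k + 2`. If `x` is on `f`, both equal `f`.
      ¬conflict-trans : ∀ {f g h} → f ∈ₗ L → g ∈ₗ L → h ∈ₗ L → ¬ Conflict g f → ¬ Conflict h f → ¬ Conflict g h
      ¬conflict-trans {f} {g} {h} f∈L g∈L h∈L ¬g∼f ¬h∼f (g≢h , x , x∈g∩h)
        with x∈p∩q⁻ g h x∈g∩h
      ... | x∈g , x∈h with x ∈? f
      ...   | yes x∈f = g≢h (trans (¬conflict⇒≡ ¬g∼f x∈g x∈f) (sym (¬conflict⇒≡ ¬h∼f x∈h x∈f)))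
      ...   | no  x∉f = <⇒≢ (two-disjoint-through joined f∈L x∉f (∈-star⁺ g∈L x∈g) (∈-star⁺ h∈L x∈h)
                  g≢h (¬g∼f ∘ conflict-sym) (¬h∼f ∘ conflict-sym))
                (trans (cong suc (size f∈L)) (sym (regular x)))

      proper : ∀ {g h} → g ∈ₗ L → h ∈ₗ L → Conflict g h → c g ≢ c h
      proper {g} {h} g∈L h∈L g∼h cg≡ch
        with position-≡ (∥? g) (∥? h) (parallel g∈L) (parallel h∈L) cg≡ch
      ... | f , f∋p , ¬g∼f , ¬h∼f = ¬conflict-trans (proj₁ (∈-star⁻ f∋p)) g∈L h∈L ¬g∼f ¬h∼f g∼h

    -- Families whose members have at least `k` vertices.

    module _ {j D : ℕ} (k≤ : ∀ {f} → f ∈ₗ L → suc j ≤ ∣ f ∣)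
             (∑-sizes≤ : ∀ x → ∑[ f ← star L x ] ∣ f ∣ ≤ d x + D) where

      -- With `k` as a successor, k - 1 is `j` and no truncated subtraction arises. `D` stands for
      -- the maximum degree of the 2-section.
      k = suc j

      j*d≤D : ∀ x → j * d x ≤ D
      j*d≤D x = +-cancelˡ-≤ (d x) (j * d x) D
        (≤-trans (≤-reflexive (*-comm k (d x))) (≤-trans (d*k≤∑-sizes k≤ x) (∑-sizes≤ x)))

      -- Sum `j * d x` over `e`: the vertex `x₀` contributes at most `j * k` and each of the other
      -- `j` vertices at most `D`, in total `j * (D + k)`. Then cancel `j`.
      few-neighbours : ∀ {e x₀} → 1 ≤ j → e ∈ₗ L → ∣ e ∣ ≡ k → x₀ ∈ e → d x₀ ≤ k → neighbours L e ≤ D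
      few-neighbours {e} {x₀} 1≤j e∈L ∣e∣≡k x₀∈e d≤k =
        +-cancelʳ-≤ k (neighbours L e) D (*-cancelˡ-≤ j {{>-nonZero 1≤j}} (begin
          j * (neighbours L e + k)
            ≡⟨ cong (λ t → j * (neighbours L e + t)) ∣e∣≡k ⟨
          j * (neighbours L e + ∣ e ∣)
            ≤⟨ *-monoʳ-≤ j (neighbours≤∑-d e∈L) ⟩
          j * ∑ (vertices e) d
            ≡⟨ ∑-* (vertices e) j d ⟨
          ∑[ x ← vertices e ] (j * d x)
            ≤⟨ +-cancelʳ-≤ D _ (j * (D + k)) weighted ⟩
          j * (D + k) ∎))
        where
        open ≤-Reasoning
        ∑-x₀ : ∀ c → ∑[ x ← vertices e ] (c * 𝟏 (x Fin.≟ x₀)) ≡ c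
        ∑-x₀ c = ∑-indicator Fin._≟_ c (unique-vertices e) (∈-vertices⁺ x₀∈e)
        -- At `x₀` the bound `D` is exchanged for `j * k`; the `D` given up is added on the left
        -- instead of subtracted on the right.
        pointwise : ∀ x → j * d x + D * 𝟏 (x Fin.≟ x₀) ≤ D + (j * k) * 𝟏 (x Fin.≟ x₀)
        pointwise x with x Fin.≟ x₀
        ... | yes refl rewrite *-identityʳ D | *-identityʳ (j * k) | +-comm D (j * k) =
                +-monoˡ-≤ D (*-monoʳ-≤ j d≤k)
        ... | no _ rewrite *-zeroʳ D | *-zeroʳ (j * k) | +-identityʳ (j * d x) | +-identityʳ D = j*d≤D x
        weighted : ∑[ x ← vertices e ] (j * d x) + D ≤ j * (D + k) + D
        weighted = begin
          ∑[ x ← vertices e ] (j * d x) + D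
            ≡⟨ cong (∑ (vertices e) (λ x → j * d x) +_) (∑-x₀ D) ⟨
          ∑[ x ← vertices e ] (j * d x) + ∑[ x ← vertices e ] (D * 𝟏 (x Fin.≟ x₀))
            ≡⟨ ∑-+ (vertices e) (λ x → j * d x) (λ x → D * 𝟏 (x Fin.≟ x₀)) ⟨
          ∑[ x ← vertices e ] (j * d x + D * 𝟏 (x Fin.≟ x₀))
            ≤⟨ ∑-mono (vertices e) (λ {x} _ → pointwise x) ⟩
          ∑[ x ← vertices e ] (D + (j * k) * 𝟏 (x Fin.≟ x₀))
            ≡⟨ ∑-+ (vertices e) (λ _ → D) (λ x → (j * k) * 𝟏 (x Fin.≟ x₀)) ⟩
          ∑[ _ ← vertices e ] D + ∑[ x ← vertices e ] ((j * k) * 𝟏 (x Fin.≟ x₀))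
            ≡⟨ cong₂ _+_ (trans (∑-vertices-const e D) (cong (_* D) ∣e∣≡k)) (∑-x₀ (j * k)) ⟩
          D + j * D + j * k
            ≡⟨ +-assoc D (j * D) (j * k) ⟩
          D + (j * D + j * k)
            ≡⟨ +-comm D (j * D + j * k) ⟩
          j * D + j * k + D
            ≡⟨ cong (_+ D) (*-distribˡ-+ j D k) ⟨
          j * (D + k) + D ∎

      -- The sum of `k * d x` over `e` exceeds `k * (k + D)`, so some vertex has `k * d x` above the
      -- average `k + D`. Removing `j * d x ≤ D` leaves `k < d x`.
      high-degree-vertex : ∀ {e} → e ∈ₗ L → ∣ e ∣ ≡ k → D < neighbours L e → ∃ λ x → x ∈ e × k < d x
      high-degree-vertex {e} e∈L ∣e∣≡k many with ∑-< (vertices e) {λ _ → k + D} {λ x → k * d x} (begin-strict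
        ∑[ _ ← vertices e ] (k + D)        ≡⟨ ∑-vertices-const e (k + D) ⟩
        ∣ e ∣ * (k + D)                    ≡⟨ cong (_* (k + D)) ∣e∣≡k ⟩
        k * (k + D)                        <⟨ *-monoʳ-< k (+-monoʳ-< k many) ⟩
        k * (k + neighbours L e)           ≡⟨ cong (k *_) (+-comm k (neighbours L e)) ⟩
        k * (neighbours L e + k)           ≡⟨ cong (λ t → k * (neighbours L e + t)) ∣e∣≡k ⟨
        k * (neighbours L e + ∣ e ∣)       ≤⟨ *-monoʳ-≤ k (neighbours≤∑-d e∈L) ⟩
        k * ∑ (vertices e) d               ≡⟨ ∑-* (vertices e) k d ⟨
        ∑[ x ← vertices e ] (k * d x)      ∎)
        where open ≤-Reasoning
      ... | x , x∈Ve , k+D<k*d = x , ∈-vertices⁻ x∈Ve ,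
            +-cancelʳ-< D k (d x) (<-≤-trans k+D<k*d (+-monoʳ-≤ (d x) (j*d≤D x)))

      -- The extremal case: an affine plane of order `k`.

      module AffinePlane (n≤k² : n ≤ k * k) (many : ∀ {f} → f ∈ₗ L → D < neighbours L f)
                         {e} (e∈L : e ∈ₗ L) (∣e∣≡k : ∣ e ∣ ≡ k) (1≤j : 1 ≤ j) where

        -- As k is suc j, the left-hand side is k² − 1.
        k²-1≤D : j * suc k ≤ D
        k²-1≤D with high-degree-vertex e∈L ∣e∣≡k (many e∈L)
        ... | x , _ , k<d = ≤-trans (*-monoʳ-≤ j k<d) (j*d≤D x)

        k*k≡1+j*[1+k] : k * k ≡ suc (j * suc k)
        k*k≡1+j*[1+k] = cong suc (sym (*-suc j k))

        -- From `d x * k + 1 ≤ n + d x` and `n ≤ k * k` follows `j * d x ≤ k * k − 1`, which factors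
        -- as `j * suc k`.
        d≤k+1 : ∀ x → d x ≤ suc k
        d≤k+1 x = *-cancelˡ-≤ j {{>-nonZero 1≤j}} (s≤s⁻¹ (+-cancelˡ-≤ (d x) _ _ (begin
          d x + suc (j * d x)              ≡⟨ +-suc (d x) (j * d x) ⟩
          suc (k * d x)                    ≡⟨ cong suc (*-comm k (d x)) ⟩
          suc (d x * k)                    ≤⟨ s≤s (d*k≤∑-sizes k≤ x) ⟩
          suc (∑[ f ← star L x ] ∣ f ∣)    ≡⟨ +-comm 1 _ ⟩
          ∑[ f ← star L x ] ∣ f ∣ + 1      ≤⟨ ∑-sizes<n+d x ⟩
          n + d x                          ≤⟨ +-monoˡ-≤ (d x) (≤-trans n≤k² (≤-reflexive k*k≡1+j*[1+k])) ⟩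
          suc (j * suc k) + d x            ≡⟨ +-comm _ (d x) ⟩
          d x + suc (j * suc k)            ∎)))
          where open ≤-Reasoning

        -- `g` meets more than `D ≥ k * k − 1` others, so its degrees sum to at least `k * k + k`.
        -- That is `k` times their upper bound `suc k`.
        d≡k+1 : ∀ {x g} → g ∈ₗ L → ∣ g ∣ ≡ k → x ∈ g → d x ≡ suc k
        d≡k+1 {g = g} g∈L ∣g∣≡k = ∑-d≤∣e∣*c⇒d≡c d≤k+1 (begin
          ∣ g ∣ * suc k                ≡⟨ cong (_* suc k) ∣g∣≡k ⟩
          suc k + j * suc k            ≡⟨ +-comm (suc k) (j * suc k) ⟩
          j * suc k + suc k            ≡⟨ +-suc (j * suc k) k ⟩
          suc (j * suc k) + k          ≤⟨ +-monoˡ-≤ k (≤-trans (s≤s k²-1≤D) (many g∈L)) ⟩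
          neighbours L g + k           ≡⟨ cong (neighbours L g +_) ∣g∣≡k ⟨
          neighbours L g + ∣ g ∣       ≤⟨ neighbours≤∑-d g∈L ⟩
          ∑[ x ← vertices g ] d x      ∎)
          where open ≤-Reasoning

        -- Closes the chain `d x * k + 1 ≤ ∑ sizes + 1 ≤ n + d x`. Equality on the right gives
        -- `joined`, on the left `size-through`.
        n+d≤ : ∀ {x} → d x ≡ suc k → n + d x ≤ d x * k + 1
        n+d≤ {x} d≡ = begin
          n + d x              ≡⟨ cong (n +_) d≡ ⟩
          n + suc k            ≤⟨ +-monoˡ-≤ (suc k) n≤k² ⟩
          k * k + suc k        ≡⟨ +-suc (k * k) k ⟩
          suc (k * k + k)      ≡⟨ cong suc (+-comm (k * k) k) ⟩
          suc (suc k * k)      ≡⟨ +-comm 1 (suc k * k) ⟩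
          suc k * k + 1        ≡⟨ cong (λ t → t * k + 1) d≡ ⟨
          d x * k + 1          ∎
          where open ≤-Reasoning

        joined : ∀ {x y} → d x ≡ suc k → x ≢ y → codeg x y ≡ 1
        joined {x} d≡ = codeg≡1 (≤-trans (n+d≤ d≡) (+-monoˡ-≤ 1 (d*k≤∑-sizes k≤ x)))

        size-through : ∀ {x f} → d x ≡ suc k → f ∈ₗ L → x ∈ f → ∣ f ∣ ≡ k
        size-through {x} d≡ f∈L x∈f = sym (∑-tight (star L x) (λ f∋x → k≤ (proj₁ (∈-star⁻ f∋x)))
          (+-cancelʳ-≤ 1 _ _ (≤-trans (∑-sizes<n+d x)
            (≤-trans (n+d≤ d≡) (≤-reflexive (cong (_+ 1) (sym (∑-const (star L x) k)))))))
          (∈-star⁺ f∈L x∈f))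

        -- Regularity spreads from `e`: full degree on `e` fixes the sizes of all members, and the
        -- members through `p`, now of size `k`, carry full degree to every vertex.
        colouring : ∀ {p} → p ∈ e → Colouring L (suc k)
        colouring {p} p∈e = parallel-colouring (λ {x} → joined (regular x)) size regular p
          where
          d-on-e : ∀ {x} → x ∈ e → d x ≡ suc k
          d-on-e = d≡k+1 e∈L ∣e∣≡k

          size : ∀ {f} → f ∈ₗ L → ∣ f ∣ ≡ k
          size {f} f∈L with p ∈? f | conflict? f e
          ... | yes p∈f | _ = size-through (d-on-e p∈e) f∈L p∈f
          ... | no  _   | yes (_ , x , x∈f∩e) = let x∈f , x∈e = x∈p∩q⁻ f e x∈f∩e in
                  size-through (d-on-e x∈e) f∈L x∈f
          -- A member disjoint from `e` has fewer than `d p`, that is at most `k`, vertices.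
          ... | no  p∉f | no ¬f∼e = ≤-antisym
                  (s≤s⁻¹ (subst (∣ f ∣ <_) (d-on-e p∈e)
                    (disjoint-through (joined (d-on-e p∈e)) f∈L p∉f (∈-star⁺ e∈L p∈e) ¬f∼e)))
                  (k≤ f∈L)

          regular : ∀ x → d x ≡ suc k
          regular x with p Fin.≟ x
          ... | yes refl = d-on-e p∈e
          ... | no p≢x with Any.any? (x ∈?_) (star L p)
          ...   | no ¬any = contradiction (trans (sym (joined (d-on-e p∈e) p≢x))
                    (count-none (x ∈?_) (star L p) λ f∋p x∈f → ¬any (lose f∋p x∈f))) λ ()
          ...   | yes any with find any
          ...     | f , f∋p , x∈f = let f∈L , _ = ∈-star⁻ f∋p in d≡k+1 f∈L (size f∈L) x∈f

        k+1≤1+D : suc k ≤ suc D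
        k+1≤1+D = s≤s (≤-trans (n≤1+n k) (≤-trans (≤-reflexive (sym (*-identityˡ (suc k))))
          (≤-trans (*-monoˡ-≤ (suc k) 1≤j) k²-1≤D)))

-- Unfolding the maximum degree and the antirank.

degree≤Δ : ∀ {n} (G : SimpleGraph n) x → degree G x ≤ Δ G
degree≤Δ {n} G x = All.lookup (xs≤max 0 (map (degree G) (allFin n))) (∈-map⁺ (degree G) (∈-allFin x))

-- Lying below the finite `[ m ]` excludes `a = ⊤⁺`, for which `√ n ≤⁺ a` carries no information.
√≤⁺-mono : ∀ {n a m} → √ n ≤⁺ a → a ≤⁺ [ m ] → n ≤ m * m
√≤⁺-mono n≤k² [ k≤m ] = ≤-trans n≤k² (*-mono-≤ k≤m k≤m)

√n≤ar⇒n≤∣e∣² : ∀ {n} (H : Hypergraph n) → √ n ≤⁺ ar H → ∀ {e} → e ∈ₗ edges H → n ≤ ∣ e ∣ * ∣ e ∣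
√n≤ar⇒n≤∣e∣² H √n≤ar e∈H = √≤⁺-mono √n≤ar
  (All.lookup (min≤xs ⊤⁺ (map (λ e → [ ∣ e ∣ ]) (edges H))) (∈-map⁺ (λ e → [ ∣ e ∣ ]) e∈H))

-- Induction over subfamilies of the hyperedges.

module _ {n : ℕ} (H : Hypergraph n) (linear : Linear H) (loopless : Loopless H)
         (long-or-low-degree : ∀ {e} → e ∈ₗ edges H → n ≤ ∣ e ∣ * ∣ e ∣ ⊎ ∃ λ x₀ → x₀ ∈ e × deg H x₀ ≤ ∣ e ∣)
         where

  unique-edge : ∀ {e f x y} → e ∈ₗ edges H → f ∈ₗ edges H → x ≢ y →
                x ∈ e → y ∈ e → x ∈ f → y ∈ f → e ≡ f
  unique-edge {e} {f} e∈H f∈H x≢y x∈e y∈e x∈f y∈f = decidable-stable (e ≟ₛ f) λ e≢f →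
    <⇒≱ (two-elements x≢y (x∈p∩q⁺ (x∈e , x∈f)) (x∈p∩q⁺ (y∈e , y∈f))) (linear e∈H f∈H e≢f)

  -- Nonemptiness excludes size 0 and looplessness size 1; the resulting `1 ≤ j` permits cancelling
  -- `j` in the counts.
  edge-size : ∀ {e} → e ∈ₗ edges H → ∃ λ j → 1 ≤ j × ∣ e ∣ ≡ suc j
  edge-size {e} e∈H with ∣ e ∣ in ∣e∣≡ | All.lookup (nonempty H) e∈H
  ... | zero        | x , x∈e = contradiction (subst (∣ e - x ∣ <_) ∣e∣≡ (x∈p⇒∣p-x∣<∣p∣ x∈e)) n≮0
  ... | suc zero    | _       = contradiction ∣e∣≡ (loopless e∈H)
  ... | suc (suc j) | _       = suc j , s≤s z≤n , refl

  module _ (L : List (Subset n)) (unique : Unique L) (L⊆H : ∀ {f} → f ∈ₗ L → f ∈ₗ edges H) where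

    open LinearFamily L unique (λ e∈L f∈L → unique-edge (L⊆H e∈L) (L⊆H f∈L))

    d≤deg : ∀ x → d x ≤ deg H x
    d≤deg x = length-mono-⊆ _≟ₛ_ (unique-star x) λ f∋x →
      let f∈L , x∈f = ∈-star⁻ f∋x in ∈-filter⁺ (x ∈?_) (L⊆H f∈L) x∈f

    ∑-sizes≤d+Δ : ∀ x → ∑[ f ← star L x ] ∣ f ∣ ≤ d x + Δ [ H ]₂
    ∑-sizes≤d+Δ x = ≤-trans (∑-sizes≤d+degree H L⊆H x) (+-monoʳ-≤ (d x) (degree≤Δ [ H ]₂ x))

    -- Minimality makes `∣ e ∣` the common lower bound `k` on sizes. A long `e` leads to the affine
    -- plane, one with a vertex of low degree to a contradiction with crowding.
    colouring-of-crowded : ∀ {e} → e ∈ₗ L → (∀ {f} → f ∈ₗ L → ∣ e ∣ ≤ ∣ f ∣) →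
      (∀ {f} → f ∈ₗ L → Δ [ H ]₂ < neighbours L f) → Colouring L (suc (Δ [ H ]₂))
    colouring-of-crowded {e} e∈L minimal many with edge-size (L⊆H e∈L) | long-or-low-degree (L⊆H e∈L)
    ... | j , 1≤j , ∣e∣≡1+j | inj₁ n≤∣e∣² = weaken-colouring k+1≤1+D
            (colouring (proj₂ (All.lookup (nonempty H) (L⊆H e∈L))))
      where
      open AffinePlane (λ {f} f∈L → subst (_≤ ∣ f ∣) ∣e∣≡1+j (minimal f∈L)) ∑-sizes≤d+Δ
        (subst (λ k → n ≤ k * k) ∣e∣≡1+j n≤∣e∣²) many e∈L ∣e∣≡1+j 1≤j
    ... | j , 1≤j , ∣e∣≡1+j | inj₂ (x₀ , x₀∈e , deg≤) = contradiction
            (few-neighbours (λ {f} f∈L → subst (_≤ ∣ f ∣) ∣e∣≡1+j (minimal f∈L)) ∑-sizes≤d+Δ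
              1≤j e∈L ∣e∣≡1+j x₀∈e (≤-trans (d≤deg x₀) (subst (deg H x₀ ≤_) ∣e∣≡1+j deg≤)))
            (<⇒≱ (many e∈L))

  -- `m` bounds the length so that the recursion is structural, since `delete e L` is not a subterm
  -- of `L`.
  colour-family : ∀ m L → length L ≤ m → Unique L → (∀ {f} → f ∈ₗ L → f ∈ₗ edges H) →
                  Colouring L (suc (Δ [ H ]₂))
  colour-family m       []           _     _      _   = (λ _ → 0) , (λ ()) , λ ()
  colour-family (suc m) L@(e₀ ∷ es) ∣L∣≤ unique L⊆H
    with Any.any? (λ e → neighbours L e ≤? Δ [ H ]₂) L
  ... | yes some-few = let e , e∈L , few = find some-few in
        extend-colouring (s≤s few) (colour-family m (delete e L)
          (s≤s⁻¹ (≤-trans (filter-notAll (λ f → ¬? (f ≟ₛ e)) L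
            (Any.map (λ e≡f f≢e → f≢e (sym e≡f)) e∈L)) ∣L∣≤))
          (filter⁺ (λ f → ¬? (f ≟ₛ e)) unique)
          (L⊆H ∘ proj₁ ∘ ∈-filter⁻ (λ f → ¬? (f ≟ₛ e))))
  ... | no none-few = colouring-of-crowded L unique L⊆H
        -- The minimum is searched from `e₀` through `es`, so it is itself a member of `L`.
        (argmin-all ∣_∣ {e₀} {es} {_∈ₗ L} (here refl) (All.tabulate there))
        (All.lookup (f[argmin]≤f[⊤] {f = ∣_∣} e₀ es ∷ f[argmin]≤f[xs] {f = ∣_∣} e₀ es))
        (λ f∈L → ≰⇒> (none-few ∘ lose f∈L))

  q≤Δ+1 : q H ≤ Δ [ H ]₂ + 1
  q≤Δ+1 with colour-family _ (edges H) ≤-refl (distinct H) id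
  ... | c , c<k , proper = subst (q H ≤_) (+-comm 1 (Δ [ H ]₂)) (proj₂ (q-isLeast H)
    ( (λ i → Fin.fromℕ< (c<k (∈-lookup {xs = edges H} i)))
    , λ i j e≢f meet same → proper (∈-lookup i) (∈-lookup j) (e≢f , meet)
        (Fin.fromℕ<-injective _ _ (c<k (∈-lookup i)) (c<k (∈-lookup j)) same)))

theorem5p3 : ∀ (n : ℕ) (H H′ : Hypergraph n) (E″ : List (Subset n)) →
    Linear H →
    Loopless H →
    edges H ↭ edges H′ ++ E″ →
    √ n ≤⁺ ar H′ →
    (∀ {e} → e ∈ₗ E″ → ∣ e ∣ <√ n) →
    (∀ {e} → e ∈ₗ E″ → ∃ λ x₀ → x₀ ∈ e × deg H x₀ ≤ ∣ e ∣) →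
    q H ≤ Δ [ H ]₂ + 1
theorem5p3 n H H′ E″ linear loopless E↭E′++E″ √n≤ar _ small = q≤Δ+1 H linear loopless split
  where
  split : ∀ {e} → e ∈ₗ edges H → n ≤ ∣ e ∣ * ∣ e ∣ ⊎ ∃ λ x₀ → x₀ ∈ e × deg H x₀ ≤ ∣ e ∣
  split e∈H with ∈-++⁻ (edges H′) (∈-resp-↭ E↭E′++E″ e∈H)
  ... | inj₁ e∈E′ = inj₁ (√n≤ar⇒n≤∣e∣² H′ √n≤ar e∈E′)
  ... | inj₂ e∈E″ = inj₂ (small e∈E″)
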